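{- For every formula $A$ provable in the logic $\mathsf{K}^+$ there exists a normal realization $B$ of $A$ such that $B$ has an injective proof in the justification logic $\mathsf{J}^+$.
   Context: Formulas of $\mathsf{K}^+$ are built from propositional variables $p_0,p_1,\dots$ and $\bot$ by $\to$, $\Box$, $\Box^+$; $\neg A:=A\to\bot$, $\top:=\neg\bot$, $A\wedge B:=\neg(A\to\neg B)$, $A\vee B:=\neg A\to B$. The logic $\mathsf{K}^+$ is axiomatized by: $A\to(B\to A)$; $(A\to(B\to C))\to((A\to B)\to(A\to C))$; $\neg\neg A\to A$; $\Box(A\to B)\to(\Box A\to\Box B)$; $\Box^+(A\to B)\to(\Box^+A\to\Box^+B)$; $\Box^+A\to\Box A$; $\Box^+A\to\Box\Box^+A$; $\Box A\wedge\Box^+(A\to\Box A)\to\Box^+A$; with rules modus ponens (from $A$ and $A\to B$ infer $B$) and necessitation (from $A$ infer $\Box^+A$). Justification terms of two sorts are built simultaneously from first-sort variables $x_0,x_1,\dots$, second-sort variables $y_0,y_1,\dots$ and second-sort constants $c_0,c_1,\dots$: first-sort terms $w::=x_i\mid (w\cdot w)\mid \mathsf{head}(s)\mid\mathsf{tail}(s)\mid (w+w)$; second-sort terms $s::=y_i\mid c_i\mid (s\cdot s)\mid \mathsf{ind}(w,s)\mid (s+s)$. Justification formulas: $A::=p_i\mid\bot\mid (A\to A)\mid [w]A\mid [s]_{\mathsf{tc}}A$ ($w$ first-sort, $s$ second-sort), with the same Boolean abbreviations. $\mathsf{J}^+_0$ has the single rule modus ponens and the axioms, for all formulas $A,B,C$,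 first-sort terms $h,w$, second-sort terms $t,s$: (i) $A\to(B\to A)$; (ii) $(A\to(B\to C))\to((A\to B)\to(A\to C))$; (iii) $\neg\neg A\to A$; (iv) $[h](A\to B)\to([w]A\to[h\cdot w]B)$; (v) $[h]A\vee[w]A\to[h+w]A$; (vi) $[t]_{\mathsf{tc}}(A\to B)\to([s]_{\mathsf{tc}}A\to[t\cdot s]_{\mathsf{tc}}B)$; (vii) $[s]_{\mathsf{tc}}A\to[\mathsf{head}(s)]A$; (viii) $[s]_{\mathsf{tc}}A\to[\mathsf{tail}(s)][s]_{\mathsf{tc}}A$; (ix) $[w]A\wedge[s]_{\mathsf{tc}}(A\to[w]A)\to[\mathsf{ind}(w,s)]_{\mathsf{tc}}A$; (x) $[t]_{\mathsf{tc}}A\vee[s]_{\mathsf{tc}}A\to[t+s]_{\mathsf{tc}}A$. $\mathsf{J}^+$ is $\mathsf{J}^+_0$ plus all formulas $[c]_{\mathsf{tc}}A$ with $c$ a constant and $A$ an axiom of $\mathsf{J}^+_0$ as additional axioms. For a proof $\pi$ in $\mathsf{J}^+$, let $\mathit{cs}(\pi)$ be the set of axioms of the form $[c]_{\mathsf{tc}}A$ used in $\pi$; $\pi$ is injective if whenever $[c]_{\mathsf{tc}}A,[c]_{\mathsf{tc}}B\in\mathit{cs}(\pi)$ then $A=B$. A justification formula $B$ is a realization of a $\mathsf{K}^+$-formula $A$ if $B$ is obtained from $A$ by replacing each occurrence of $\Box$ by some first-sort term (i.e. $\Box C$ becomes $[w]C'$) and each occurrence of $\Box^+$ by some second-sort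 term (i.e. $\Box^+C$ becomes $[s]_{\mathsf{tc}}C'$). An occurrence is negative if it lies in the antecedent of an odd number of implications, positive otherwise. The realization is normal if distinct negative occurrences of $\Box$ (resp. $\Box^+$) are replaced by distinct first-sort (resp. second-sort) justification variables. -}

module Defs where

open import Data.Nat using (ℕ)
open import Data.Bool using (Bool; true; false; not)
open import Data.List using (List; []; _∷_; _++_)
open import Data.List.Membership.Propositional using (_∈_)
open import Data.List.Relation.Unary.All using (All)
open import Data.List.Relation.Unary.Unique.Propositional using (Unique)
open import Data.Product using (_×_; _,_; ∃)
open import Relation.Binary.PropositionalEquality using (_≡_)

infixr 5 _⇒_
infixr 6 _∧'_
data Fm : Set where
  var  : ℕ → Fm
  ⊥'   : Fm
  _⇒_  : Fm → Fm → Fm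
  □    : Fm → Fm
  □⁺   : Fm → Fm

¬' : Fm → Fm
¬' A = A ⇒ ⊥'

_∧'_ : Fm → Fm → Fm
A ∧' B = ¬' (A ⇒ ¬' B)

data K⁺⊢_ : Fm → Set where
  ax1   : ∀ A B → K⁺⊢ (A ⇒ (B ⇒ A))
  ax2   : ∀ A B C → K⁺⊢ ((A ⇒ (B ⇒ C)) ⇒ ((A ⇒ B) ⇒ (A ⇒ C)))
  ax3   : ∀ A → K⁺⊢ (¬' (¬' A) ⇒ A)
  axK   : ∀ A B → K⁺⊢ (□ (A ⇒ B) ⇒ (□ A ⇒ □ B))
  axK⁺  : ∀ A B → K⁺⊢ (□⁺ (A ⇒ B) ⇒ (□⁺ A ⇒ □⁺ B))
  axC1  : ∀ A → K⁺⊢ (□⁺ A ⇒ □ A)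
  axC2  : ∀ A → K⁺⊢ (□⁺ A ⇒ □ (□⁺ A))
  axInd : ∀ A → K⁺⊢ ((□ A ∧' □⁺ (A ⇒ □ A)) ⇒ □⁺ A)
  mp    : ∀ {A B} → K⁺⊢ A → K⁺⊢ (A ⇒ B) → K⁺⊢ B
  nec   : ∀ {A} → K⁺⊢ A → K⁺⊢ (□⁺ A)

mutual
  data Tm₁ : Set where
    x     : ℕ → Tm₁
    _·₁_  : Tm₁ → Tm₁ → Tm₁
    head  : Tm₂ → Tm₁
    tail  : Tm₂ → Tm₁
    _+₁_  : Tm₁ → Tm₁ → Tm₁

  data Tm₂ : Set where
    y     : ℕ → Tm₂
    c     : ℕ → Tm₂
    _·₂_  : Tm₂ → Tm₂ → Tm₂
    ind   : Tm₁ → Tm₂ → Tm₂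
    _+₂_  : Tm₂ → Tm₂ → Tm₂

infixr 5 _⟶_
infix 7 [_]_ [_]tc_
infixr 6 _j∧_ _j∨_
data JFm : Set where
  jvar  : ℕ → JFm
  j⊥    : JFm
  _⟶_   : JFm → JFm → JFm
  [_]_  : Tm₁ → JFm → JFm
  [_]tc_ : Tm₂ → JFm → JFm

j¬ : JFm → JFm
j¬ A = A ⟶ j⊥

_j∧_ : JFm → JFm → JFm
A j∧ B = j¬ (A ⟶ j¬ B)

_j∨_ : JFm → JFm → JFm
A j∨ B = j¬ A ⟶ B

data AxJ₀ : JFm → Set where
  i    : ∀ A B → AxJ₀ (A ⟶ (B ⟶ A))
  ii   : ∀ A B C → AxJ₀ ((A ⟶ (B ⟶ C)) ⟶ ((A ⟶ B) ⟶ (A ⟶ C)))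
  iii  : ∀ A → AxJ₀ (j¬ (j¬ A) ⟶ A)
  iv   : ∀ A B h w → AxJ₀ ([ h ] (A ⟶ B) ⟶ ([ w ] A ⟶ [ h ·₁ w ] B))
  v    : ∀ A h w → AxJ₀ (([ h ] A j∨ [ w ] A) ⟶ [ h +₁ w ] A)
  vi   : ∀ A B t s → AxJ₀ ([ t ]tc (A ⟶ B) ⟶ ([ s ]tc A ⟶ [ t ·₂ s ]tc B))
  vii  : ∀ A s → AxJ₀ ([ s ]tc A ⟶ [ head s ] A)
  viii : ∀ A s → AxJ₀ ([ s ]tc A ⟶ [ tail s ] ([ s ]tc A))
  ix   : ∀ A w s → AxJ₀ (([ w ] A j∧ [ s ]tc (A ⟶ [ w ] A)) ⟶ [ ind w s ]tc A)
  x'   : ∀ A t s → AxJ₀ (([ t ]tc A j∨ [ s ]tc A) ⟶ [ t +₂ s ]tc A)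

data J⁺Proof : JFm → Set where
  ax   : ∀ {A} → AxJ₀ A → J⁺Proof A
  csax : ∀ (n : ℕ) {A} → AxJ₀ A → J⁺Proof ([ c n ]tc A)
  mp   : ∀ {A B} → J⁺Proof A → J⁺Proof (A ⟶ B) → J⁺Proof B

cs : ∀ {A} → J⁺Proof A → List (ℕ × JFm)
cs (ax _)           = []
cs (csax n {A} _)   = (n , A) ∷ []
cs (mp π ρ)         = cs π ++ cs ρ

Injective : ∀ {A} → J⁺Proof A → Set
Injective π = ∀ n A B → (n , A) ∈ cs π → (n , B) ∈ cs π → A ≡ B

data Realization : Fm → JFm → Set where
  rvar : ∀ n → Realization (var n) (jvar n)
  r⊥   : Realization ⊥' j⊥
  r⇒   : ∀ {A B A' B'} → Realization A A' → Realization B B' →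
         Realization (A ⇒ B) (A' ⟶ B')
  r□   : ∀ {A A'} (w : Tm₁) → Realization A A' → Realization (□ A) ([ w ] A')
  r□⁺  : ∀ {A A'} (s : Tm₂) → Realization A A' → Realization (□⁺ A) ([ s ]tc A')

-- Terms replacing negative occurrences, listed in order of occurrence.
-- The Bool is the polarity: true = positive, false = negative.
neg₁ : Bool → JFm → List Tm₁
neg₁ p (jvar _)    = []
neg₁ p j⊥          = []
neg₁ p (A ⟶ B)     = neg₁ (not p) A ++ neg₁ p B
neg₁ true ([ w ] A)  = neg₁ true A
neg₁ false ([ w ] A) = w ∷ neg₁ false A
neg₁ p ([ s ]tc A) = neg₁ p A

neg₂ : Bool → JFm → List Tm₂
neg₂ p (jvar _)    = []
neg₂ p j⊥          = []
neg₂ p (A ⟶ B)     = neg₂ (not p) A ++ neg₂ p B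
neg₂ p ([ w ] A)   = neg₂ p A
neg₂ true ([ s ]tc A)  = neg₂ true A
neg₂ false ([ s ]tc A) = s ∷ neg₂ false A

IsVar₁ : Tm₁ → Set
IsVar₁ t = ∃ λ n → t ≡ x n

IsVar₂ : Tm₂ → Set
IsVar₂ t = ∃ λ n → t ≡ y n

Normal : JFm → Set
Normal B = (All IsVar₁ (neg₁ true B) × Unique (neg₁ true B))
         × (All IsVar₂ (neg₂ true B) × Unique (neg₂ true B))

{-# OPTIONS --safe #-}

-- A cut-free calculus for K⁺ with a rule for positive □⁺B that closes a finite
-- cluster of sequents Z: each member proves B, and each member leads, after one modal
-- step, back into Z.  Proof search over the finitely many sets of signed
-- subformulas yields either a derivation or a finite Kripke countermodel.
--
-- To realize a derivation, all positive □ are replaced by one term a and all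
-- positive □⁺ by one term b, sums of the terms produced by the modal rules.  There is
-- no circularity because, with a single constant for all axioms, the internalization
-- of a proof depends only on the tree shape of the proof and not on the formulas in
-- it.  For a cluster Z with disjunction χ, internalizing χ → [a]χ as s gives
-- ind(a, s) for χ, so a itself serves as the induction term.  At the end the constant
-- is replaced by a sum of distinct constants, one for each of its uses.
module Submission where

open import Defs
import Data.Bool as Bool
open import Data.Bool using (Bool; true; false; not)
open import Data.Empty using (⊥; ⊥-elim)
open import Data.List using (List; []; _∷_; _++_; map; length; filter)
open import Data.List.Membership.Propositional using (_∈_; _∉_; find; lose)
open import Data.List.Membership.Propositional.Properties
  using (∈-++⁺ˡ; ∈-++⁺ʳ; ∈-++⁻; ∈-map⁺; ∈-map⁻; ∈-filter⁺; ∈-filter⁻)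
open import Data.List.Properties using (map-++; ++-identityʳ)
import Data.List.Properties as List
open import Data.List.Relation.Binary.Subset.Propositional using (_⊆_)
open import Data.List.Relation.Unary.All using (All; []; _∷_; all?)
import Data.List.Relation.Unary.All as All
import Data.List.Relation.Unary.All.Properties as All
open import Data.List.Relation.Unary.Any using (Any; here; there; any?)
open import Data.List.Relation.Unary.AllPairs using ([]; _∷_)
open import Data.List.Relation.Unary.Unique.Propositional using (Unique)
import Data.List.Relation.Unary.Unique.Propositional.Properties as Unique
open import Data.Maybe using (Maybe; just; nothing)
import Data.Nat as ℕ
open import Data.Nat using (ℕ; zero; suc; _+_; _≤_; _<_; z≤n; s≤s)
open import Data.Nat.Induction using (<-wellFounded)
open import Data.Nat.Properties
  using (≤-refl; ≤-trans; <-≤-trans; m≤m+n; +-suc; +-comm; +-assoc; n≤1+n; <-irrefl;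
    suc-injective; m<1+n⇒m<n∨m≡n; m≤n⇒m≤1+n)
open import Data.Product using (Σ; Σ-syntax; ∃; ∃-syntax; _×_; _,_; proj₁; proj₂)
open import Data.Product.Properties using (≡-dec)
open import Data.Sum using (_⊎_; inj₁; inj₂; [_,_]′)
open import Data.Unit using (⊤; tt)
open import Function using (_∘_; id)
open import Induction.WellFounded using (Acc; acc)
open import Relation.Binary.Construct.Closure.Transitive using (TransClosure; _∷_)
  renaming ([_] to [_]⁺)
open import Relation.Binary.Definitions using (DecidableEquality)
open import Relation.Binary.PropositionalEquality
  using (_≡_; refl; sym; trans; cong; cong₂; subst)
open import Relation.Unary using (Decidable)
open import Relation.Nullary.Decidable using (decidable-stable)
open import Relation.Nullary using (¬_; yes; no; _×-dec_; _⊎-dec_)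

-- Labelled formulas

infixr 5 _⇒_
-- The label of a modality is the index of the variable that realizes it at a negative occurrence.
-- Both modalities draw on one counter.
data LFm : Set where
  var : ℕ → LFm
  ⊥'  : LFm
  _⇒_ : LFm → LFm → LFm
  □   : ℕ → LFm → LFm
  □⁺  : ℕ → LFm → LFm

forget : LFm → Fm
forget (var n)  = var n
forget ⊥'       = ⊥'
forget (A ⇒ B)  = forget A ⇒ forget B
forget (□ _ A)  = □ (forget A)
forget (□⁺ _ A) = □⁺ (forget A)

boxes : Fm → ℕ
boxes (var _) = 0
boxes ⊥'      = 0
boxes (A ⇒ B) = boxes A + boxes B
boxes (□ A)   = suc (boxes A)
boxes (□⁺ A)  = suc (boxes A)

label : ℕ → Fm → LFm
label k (var n) = var n
label k ⊥'      = ⊥'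
label k (A ⇒ B) = label k A ⇒ label (k + boxes A) B
label k (□ A)   = □ k (label (suc k) A)
label k (□⁺ A)  = □⁺ k (label (suc k) A)

forget-label : ∀ k A → forget (label k A) ≡ A
forget-label k (var n) = refl
forget-label k ⊥'      = refl
forget-label k (A ⇒ B) = cong₂ _⇒_ (forget-label k A) (forget-label (k + boxes A) B)
forget-label k (□ A)   = cong □ (forget-label (suc k) A)
forget-label k (□⁺ A)  = cong □⁺ (forget-label (suc k) A)

ρ : Tm₁ → Tm₂ → Bool → LFm → JFm
ρ a b p     (var n)  = jvar n
ρ a b p     ⊥'       = j⊥
ρ a b p     (A ⇒ B)  = ρ a b (not p) A ⟶ ρ a b p B
ρ a b true  (□ n A)  = [ a ] ρ a b true A
ρ a b false (□ n A)  = [ x n ] ρ a b false A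
ρ a b true  (□⁺ n A) = [ b ]tc ρ a b true A
ρ a b false (□⁺ n A) = [ y n ]tc ρ a b false A

ρ-realization : ∀ a b p A → Realization (forget A) (ρ a b p A)
ρ-realization a b p     (var n)  = rvar n
ρ-realization a b p     ⊥'       = r⊥
ρ-realization a b p     (A ⇒ B)  = r⇒ (ρ-realization a b (not p) A) (ρ-realization a b p B)
ρ-realization a b true  (□ n A)  = r□ _ (ρ-realization a b true A)
ρ-realization a b false (□ n A)  = r□ _ (ρ-realization a b false A)
ρ-realization a b true  (□⁺ n A) = r□⁺ _ (ρ-realization a b true A)
ρ-realization a b false (□⁺ n A) = r□⁺ _ (ρ-realization a b false A)

-- Distinctness of indexed variables and constants

module _ {T : Set} (f : ℕ → T) (f-inj : ∀ {m n} → f m ≡ f n → m ≡ n) where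

  InRange : ℕ → ℕ → T → Set
  InRange k m t = Σ[ n ∈ ℕ ] t ≡ f n × k ≤ n × n < m

  -- The interval makes uniqueness inductive: lists over adjacent intervals are disjoint. Instances
  -- take `f` to be `x`, `y`, and `id` for constants.
  Fresh : ℕ → ℕ → List T → Set
  Fresh k m ts = All (InRange k m) ts × Unique ts

  inRange-mono : ∀ {k k' m m'} → k' ≤ k → m ≤ m' → ∀ {t} → InRange k m t → InRange k' m' t
  inRange-mono k'≤k m≤m' (n , e , k≤n , n<m) = n , e , ≤-trans k'≤k k≤n , <-≤-trans n<m m≤m'

  fresh-mono : ∀ {k k' m m' ts} → k' ≤ k → m ≤ m' → Fresh k m ts → Fresh k' m' ts
  fresh-mono p q (r , u) = All.map (inRange-mono p q) r , u

  fresh-[] : ∀ {k m} → Fresh k m []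
  fresh-[] = [] , []

  fresh-∷ : ∀ {k m ts} → k < m → Fresh (suc k) m ts → Fresh k m (f k ∷ ts)
  fresh-∷ {k} k<m (r , u) =
    (k , refl , ≤-refl , k<m) ∷ All.map (inRange-mono (n≤1+n k) ≤-refl) r ,
    All.map (λ { (n , refl , k<n , _) e → <-irrefl (f-inj e) k<n }) r ∷ u

  fresh-++ : ∀ {k l m ts us} → k ≤ l → l ≤ m → Fresh k l ts → Fresh l m us → Fresh k m (ts ++ us)
  fresh-++ k≤l l≤m (r , u) (r' , u') =
    All.++⁺ (All.map (inRange-mono ≤-refl l≤m) r) (All.map (inRange-mono k≤l ≤-refl) r') ,
    Unique.++⁺ u u' disjoint
    where
    disjoint : ∀ {t} → ¬ (t ∈ _ × t ∈ _)
    disjoint (p , q) with All.lookup r p | All.lookup r' q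
    ... | n , e , _ , n<l | n' , e' , l≤n' , _ =
      <-irrefl (f-inj (trans (sym e) e')) (<-≤-trans n<l l≤n')

  isVar : ∀ {k m ts} → Fresh k m ts → All (λ t → ∃ λ n → t ≡ f n) ts
  isVar (r , _) = All.map (λ { (n , e , _) → n , e }) r

module _ (a : Tm₁) (b : Tm₂) where

  x-inj : ∀ {m n} → x m ≡ x n → m ≡ n
  x-inj refl = refl

  y-inj : ∀ {m n} → y m ≡ y n → m ≡ n
  y-inj refl = refl

  -- The labels of `label k A` fill the interval from `k` to `k + boxes A`; positive modalities and
  -- those of the other kind only leave gaps.
  neg₁-fresh : ∀ p k A → Fresh x x-inj k (k + boxes A) (neg₁ p (ρ a b p (label k A)))
  neg₁-fresh p k (var n) = fresh-[] x x-inj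
  neg₁-fresh p k ⊥'      = fresh-[] x x-inj
  neg₁-fresh p k (A ⇒ B) rewrite sym (+-assoc k (boxes A) (boxes B)) =
    fresh-++ x x-inj (m≤m+n _ _) (m≤m+n _ _) (neg₁-fresh (not p) k A) (neg₁-fresh p _ B)
  neg₁-fresh true  k (□ A) rewrite +-suc k (boxes A) =
    fresh-mono x x-inj (n≤1+n k) ≤-refl (neg₁-fresh true (suc k) A)
  neg₁-fresh false k (□ A) rewrite +-suc k (boxes A) =
    fresh-∷ x x-inj (s≤s (m≤m+n _ _)) (neg₁-fresh false (suc k) A)
  neg₁-fresh true  k (□⁺ A) rewrite +-suc k (boxes A) =
    fresh-mono x x-inj (n≤1+n k) ≤-refl (neg₁-fresh true (suc k) A)
  neg₁-fresh false k (□⁺ A) rewrite +-suc k (boxes A) =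
    fresh-mono x x-inj (n≤1+n k) ≤-refl (neg₁-fresh false (suc k) A)

  neg₂-fresh : ∀ p k A → Fresh y y-inj k (k + boxes A) (neg₂ p (ρ a b p (label k A)))
  neg₂-fresh p k (var n) = fresh-[] y y-inj
  neg₂-fresh p k ⊥'      = fresh-[] y y-inj
  neg₂-fresh p k (A ⇒ B) rewrite sym (+-assoc k (boxes A) (boxes B)) =
    fresh-++ y y-inj (m≤m+n _ _) (m≤m+n _ _) (neg₂-fresh (not p) k A) (neg₂-fresh p _ B)
  neg₂-fresh true  k (□⁺ A) rewrite +-suc k (boxes A) =
    fresh-mono y y-inj (n≤1+n k) ≤-refl (neg₂-fresh true (suc k) A)
  neg₂-fresh false k (□⁺ A) rewrite +-suc k (boxes A) =
    fresh-∷ y y-inj (s≤s (m≤m+n _ _)) (neg₂-fresh false (suc k) A)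
  neg₂-fresh true  k (□ A) rewrite +-suc k (boxes A) =
    fresh-mono y y-inj (n≤1+n k) ≤-refl (neg₂-fresh true (suc k) A)
  neg₂-fresh false k (□ A) rewrite +-suc k (boxes A) =
    fresh-mono y y-inj (n≤1+n k) ≤-refl (neg₂-fresh false (suc k) A)

  ρ-normal : ∀ A → Normal (ρ a b true (label 0 A))
  ρ-normal A =
    (isVar x x-inj (neg₁-fresh true 0 A) , proj₂ (neg₁-fresh true 0 A)) ,
    (isVar y y-inj (neg₂-fresh true 0 A) , proj₂ (neg₂-fresh true 0 A))

-- Proof shapes

infixl 6 _∙_
-- A Hilbert derivation with its formulas erased: `hyp` carries a de Bruijn index, and `cst` stands
-- for an axiom under the constant `c 0`.
data Pf : Set where
  hyp : ℕ → Pf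
  axm : Pf
  cst : Pf
  _∙_ : Pf → Pf → Pf

infix 4 _∋_∶_
data _∋_∶_ : List JFm → ℕ → JFm → Set where
  vz : ∀ {Γ A} → A ∷ Γ ∋ zero ∶ A
  vs : ∀ {Γ A B n} → Γ ∋ n ∶ A → B ∷ Γ ∋ suc n ∶ A

infix 3 _∣_⊢_
data _∣_⊢_ (Γ : List JFm) : Pf → JFm → Set where
  hyp : ∀ {n A} → Γ ∋ n ∶ A → Γ ∣ hyp n ⊢ A
  axm : ∀ {A} → AxJ₀ A → Γ ∣ axm ⊢ A
  cst : ∀ {A} → AxJ₀ A → Γ ∣ cst ⊢ [ c 0 ]tc A
  _∙_ : ∀ {d e A B} → Γ ∣ d ⊢ A ⟶ B → Γ ∣ e ⊢ A → Γ ∣ d ∙ e ⊢ B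

shift : Pf → Pf
shift (hyp n) = hyp (suc n)
shift axm     = axm
shift cst     = cst
shift (d ∙ e) = shift d ∙ shift e

⊢shift : ∀ {Γ d A B} → Γ ∣ d ⊢ A → B ∷ Γ ∣ shift d ⊢ A
⊢shift (hyp m) = hyp (vs m)
⊢shift (axm m) = axm m
⊢shift (cst m) = cst m
⊢shift (m ∙ n) = ⊢shift m ∙ ⊢shift n

⊢closed : ∀ {d A} → [] ∣ d ⊢ A → ∀ {Γ} → Γ ∣ d ⊢ A
⊢closed (hyp ())
⊢closed (axm m) = axm m
⊢closed (cst m) = cst m
⊢closed (m ∙ n) = ⊢closed m ∙ ⊢closed n

-- Bracket abstraction, so that shapes need no binders.
abs : Pf → Pf
abs (hyp zero)    = axm ∙ axm ∙ axm
abs (hyp (suc n)) = axm ∙ hyp n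
abs axm           = axm ∙ axm
abs cst           = axm ∙ cst
abs (d ∙ e)       = axm ∙ abs d ∙ abs e

lam : ∀ {Γ d A B} → A ∷ Γ ∣ d ⊢ B → Γ ∣ abs d ⊢ A ⟶ B
lam {A = A} (hyp vz) = axm (ii A (A ⟶ A) A) ∙ axm (i A (A ⟶ A)) ∙ axm (i A A)
lam (hyp (vs m)) = axm (i _ _) ∙ hyp m
lam (axm m)     = axm (i _ _) ∙ axm m
lam (cst m)     = axm (i _ _) ∙ cst m
lam (m ∙ n)     = axm (ii _ _ _) ∙ lam m ∙ lam n

raa : ∀ {Γ d A} → j¬ A ∷ Γ ∣ d ⊢ j⊥ → Γ ∣ axm ∙ abs d ⊢ A
raa m = axm (iii _) ∙ lam m

exFalso : ∀ {Γ d A} → Γ ∣ d ⊢ j⊥ → Γ ∣ axm ∙ (axm ∙ d) ⊢ A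
exFalso m = axm (iii _) ∙ (axm (i _ _) ∙ m)

contradict : ∀ {Γ d e A} → Γ ∣ d ⊢ j¬ A → Γ ∣ e ⊢ A → ∀ {B} → Γ ∣ axm ∙ (axm ∙ (d ∙ e)) ⊢ B
contradict m n = exFalso (m ∙ n)

-- The shape is chosen before the formulas, so one shape serves all instances.
∨-injˡ : ∃[ d ] ∀ {A B} → [] ∣ d ⊢ A ⟶ A j∨ B
∨-injˡ = _ , lam (lam (contradict (hyp vz) (hyp (vs vz))))

∨-injʳ : ∃[ d ] ∀ {A B} → [] ∣ d ⊢ B ⟶ A j∨ B
∨-injʳ = _ , lam (lam (hyp (vs vz)))

∧-intro : ∃[ d ] ∀ {A B} → [] ∣ d ⊢ A ⟶ B ⟶ A j∧ B
∧-intro = _ , lam (lam (lam (hyp vz ∙ hyp (vs (vs vz)) ∙ hyp (vs vz))))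

-- The internalized term depends on the shape alone; on `hyp` its value is junk.
⟦_⟧ : Pf → Tm₂
⟦ hyp _ ⟧ = c 0
⟦ axm ⟧   = c 0
⟦ cst ⟧   = ind (tail (c 0)) (c 0)
⟦ d ∙ e ⟧ = ⟦ d ⟧ ·₂ ⟦ e ⟧

necessitate : Pf → Pf
necessitate (hyp n) = hyp n
necessitate axm     = cst
necessitate cst     = axm ∙ (proj₁ ∧-intro ∙ (axm ∙ cst) ∙ cst)
necessitate (d ∙ e) = axm ∙ necessitate d ∙ necessitate e

⊢necessitate : ∀ {d A} → [] ∣ d ⊢ A → [] ∣ necessitate d ⊢ [ ⟦ d ⟧ ]tc A
⊢necessitate (hyp ())
⊢necessitate (axm m) = cst m
-- Constants are introspected by induction on `[ c 0 ]tc A`: axiom (viii) gives the base case, and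
-- the same axiom under `c 0` gives the induction premise.
⊢necessitate (cst m) =
  axm (ix _ _ _) ∙ (proj₂ ∧-intro ∙ (axm (viii _ _) ∙ cst m) ∙ cst (viii _ _))
⊢necessitate (m ∙ n) = axm (vi _ _ _ _) ∙ ⊢necessitate m ∙ ⊢necessitate n

discharge : {T : Set} → List T → Pf → Pf
discharge []      d = d
discharge (_ ∷ s) d = discharge s (abs d)

hypIndex : {T : Set} {f : T} {s : List T} → f ∈ s → ℕ
hypIndex (here _)  = zero
hypIndex (there m) = suc (hypIndex m)

applyHyps : {T : Set} (s : List T) → (∀ {f} → f ∈ s → Pf) → Pf → Pf
applyHyps []      e d = d
applyHyps (f ∷ s) e d = applyHyps s (e ∘ there) d ∙ e (here refl)

mapPf : {T : Set} → List T → Pf → Pf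
mapPf []      e = e
mapPf (_ ∷ s) e = mapPf s (axm ∙ (axm ∙ e))

module _ {T : Set} (h : T → JFm) where

  -- The head of the list is the innermost antecedent, matching `discharge`, which abstracts index
  -- zero first.
  impl : List T → JFm → JFm
  impl []      G = G
  impl (f ∷ s) G = impl s (h f ⟶ G)

  impl-++ : ∀ s s' {G} → impl (s ++ s') G ≡ impl s' (impl s G)
  impl-++ []      s' = refl
  impl-++ (f ∷ s) s' = impl-++ s s'

  ⊢discharge : ∀ s {d G} → map h s ∣ d ⊢ G → [] ∣ discharge s d ⊢ impl s G
  ⊢discharge []      m = m
  ⊢discharge (f ∷ s) m = ⊢discharge s (lam m)

  ∋hypIndex : ∀ {f s} (m : f ∈ s) → map h s ∋ hypIndex m ∶ h f
  ∋hypIndex (here refl) = vz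
  ∋hypIndex (there m)   = vs (∋hypIndex m)

  ⊢hyp : ∀ {f s} (m : f ∈ s) → map h s ∣ hyp (hypIndex m) ⊢ h f
  ⊢hyp m = hyp (∋hypIndex m)

  ⊢applyHyps : ∀ {Γ} s {e : ∀ {f} → f ∈ s → Pf} → (∀ {f} (m : f ∈ s) → Γ ∣ e m ⊢ h f) →
    ∀ {d G} → Γ ∣ d ⊢ impl s G → Γ ∣ applyHyps s e d ⊢ G
  ⊢applyHyps []      n m = m
  ⊢applyHyps (f ∷ s) n m = ⊢applyHyps s (n ∘ there) m ∙ n (here refl)

  ⊢weaken : ∀ {s s'} (sub : s ⊆ s') {d G} → map h s ∣ d ⊢ G →
    map h s' ∣ applyHyps s (λ m → hyp (hypIndex (sub m))) (discharge s d) ⊢ G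
  ⊢weaken {s} sub m = ⊢applyHyps s (λ n → ⊢hyp (sub n)) (⊢closed (⊢discharge s m))

  ⊢map : ∀ {Γ e A B} s → Γ ∣ e ⊢ A ⟶ B → Γ ∣ mapPf s e ⊢ impl s A ⟶ impl s B
  ⊢map []      m = m
  ⊢map (f ∷ s) m = ⊢map s (axm (ii _ _ _) ∙ (axm (i _ _) ∙ m))

-- The sequent calculus

-- `false` marks hypotheses and `true` marks conclusions.
SF : Set
SF = Bool × LFm

Seq : Set
Seq = List SF

-- What a hypothesis imposes on every successor world; conclusions impose nothing.
next : SF → Seq
next (false , □ n B)  = (false , B) ∷ []
next (false , □⁺ n B) = (false , B) ∷ (false , □⁺ n B) ∷ []
next _                = []

step : Seq → Seq
step []      = []
step (f ∷ s) = next f ++ step s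

-- Index `nothing` means that the sequent is refuted outright. Under `just Y` a branch may instead
-- end in `loop`, by entering `Y` after one modal step; the modal rules do not pass `Y` to their
-- premises.
data Derivable : Maybe (List Seq) → Seq → Set where
  -- Identity is limited to variables because the two signs of a modal formula are realized
  -- differently.
  id⊢  : ∀ {Y s n} → (false , var n) ∈ s → (true , var n) ∈ s → Derivable Y s
  ⊥L   : ∀ {Y s} → (false , ⊥') ∈ s → Derivable Y s
  ⇒R   : ∀ {Y s B C} → (true , B ⇒ C) ∈ s →
         Derivable Y ((false , B) ∷ (true , C) ∷ s) → Derivable Y s
  ⇒L   : ∀ {Y s B C} → (false , B ⇒ C) ∈ s →
         Derivable Y ((true , B) ∷ s) → Derivable Y ((false , C) ∷ s) → Derivable Y s
  □R   : ∀ {Y s n B} → (true , □ n B) ∈ s →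
         Derivable nothing ((true , B) ∷ step s) → Derivable Y s
  □⁺R  : ∀ {Y s n B t} → (true , □⁺ n B) ∈ s → ∀ Z → t ∈ Z → t ⊆ step s →
         (∀ {u} → u ∈ Z → Derivable nothing ((true , B) ∷ u)) →
         (∀ {u} → u ∈ Z → Derivable (just Z) u) → Derivable Y s
  loop : ∀ {Y s t} → t ∈ Y → t ⊆ step s → Derivable (just Y) s
  wk   : ∀ {Y s t} → s ⊆ t → Derivable Y s → Derivable Y t
  drop : ∀ {Y s} → Derivable nothing s → Derivable Y s

-- Realization of derivations

module _ (a : Tm₁) (b : Tm₂) where

  hypo : SF → JFm
  hypo (false , B) = ρ a b false B
  hypo (true , B)  = j¬ (ρ a b true B)

  -- The disjunction of the conjunctions of the members: `impl hypo s j⊥` negates the conjunction of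
  -- `s`, and the implication from it encodes a disjunction.
  χ : List Seq → JFm
  χ []      = j⊥
  χ (s ∷ Y) = impl hypo s j⊥ ⟶ χ Y

  goal : Maybe (List Seq) → JFm
  goal nothing  = j⊥
  goal (just Y) = [ a ] χ Y

modalTerm₁ : SF → Tm₁ → Tm₁
modalTerm₁ (false , □ n B)  t = t ·₁ x n
-- In `impl` the persisting □⁺-formula is the outer antecedent, so `tail` is applied before `head`.
modalTerm₁ (false , □⁺ n B) t = (t ·₁ tail (y n)) ·₁ head (y n)
modalTerm₁ _                t = t

modalTerm : Seq → Tm₁ → Tm₁
modalTerm []      t = t
modalTerm (f ∷ s) t = modalTerm₁ f (modalTerm s t)

modalPf₁ : SF → Pf → Pf → Pf
modalPf₁ (false , □ n B)  e d = axm ∙ d ∙ e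
modalPf₁ (false , □⁺ n B) e d = axm ∙ (axm ∙ d ∙ (axm ∙ e)) ∙ (axm ∙ e)
modalPf₁ _                e d = d

modalPf : ∀ s {s' : Seq} → s ⊆ s' → Pf → Pf
modalPf []      sub d = d
modalPf (f ∷ s) sub d = modalPf₁ f (hyp (hypIndex (sub (here refl)))) (modalPf s (sub ∘ there) d)

⊢modal₁ : ∀ {a b Γ} f {e d t G} → Γ ∣ e ⊢ hypo a b f →
  Γ ∣ d ⊢ [ t ] impl (hypo a b) (next f) G → Γ ∣ modalPf₁ f e d ⊢ [ modalTerm₁ f t ] G
⊢modal₁ (false , var _)   n m = m
⊢modal₁ (false , ⊥')      n m = m
⊢modal₁ (false , _ ⇒ _)   n m = m
⊢modal₁ (false , □ _ _)   n m = axm (iv _ _ _ _) ∙ m ∙ n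
⊢modal₁ (false , □⁺ _ _)  n m =
  axm (iv _ _ _ _) ∙ (axm (iv _ _ _ _) ∙ m ∙ (axm (viii _ _) ∙ n)) ∙ (axm (vii _ _) ∙ n)
⊢modal₁ (true , var _)    n m = m
⊢modal₁ (true , ⊥')       n m = m
⊢modal₁ (true , _ ⇒ _)    n m = m
⊢modal₁ (true , □ _ _)    n m = m
⊢modal₁ (true , □⁺ _ _)   n m = m

⊢modal : ∀ {a b} s {s'} (sub : s ⊆ s') {d t G} →
  map (hypo a b) s' ∣ d ⊢ [ t ] impl (hypo a b) (step s) G →
  map (hypo a b) s' ∣ modalPf s sub d ⊢ [ modalTerm s t ] G
⊢modal []      sub m = m
⊢modal {a} {b} (f ∷ s) sub {G = G} m
  rewrite impl-++ (hypo a b) (next f) (step s) {G} =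
  ⊢modal₁ f (⊢hyp (hypo a b) (sub (here refl))) (⊢modal s (sub ∘ there) m)

stepTerm : Seq → Pf → Tm₁
stepTerm s d = modalTerm s (head ⟦ discharge (step s) d ⟧)

stepPf : Seq → Pf → Pf
stepPf s d = modalPf s id (axm ∙ necessitate (discharge (step s) d))

-- The discharged proof is closed, hence can be necessitated; the modal hypotheses of `s` then
-- supply its antecedents one by one. The resulting term mentions neither `a` nor `b`.
⊢step : ∀ {a b} s {d G} → map (hypo a b) (step s) ∣ d ⊢ G →
  map (hypo a b) s ∣ stepPf s d ⊢ [ stepTerm s d ] G
⊢step {a} {b} s m =
  ⊢modal s id (axm (vii _ _) ∙ ⊢closed (⊢necessitate (⊢discharge (hypo a b) (step s) m)))

-- The summands contributed by a derivation are known before the total sums a and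
-- b (the realizers of all positive boxes); the shapes j and k of the injections of
-- the former into the latter are supplied from outside.  Summands of b may mention a.
Realizable : {D : Set} → (Tm₁ → Tm₂ → D → Set) → Set
Realizable {D} Q = ∀ (j k : Pf) →
  Σ[ a₀ ∈ Tm₁ ] Σ[ b₀ ∈ (Tm₁ → Tm₂) ] Σ[ d ∈ D ] (∀ a b →
    (∀ {A} → [] ∣ j ⊢ [ a₀ ] A ⟶ [ a ] A) →
    (∀ {A} → [] ∣ k ⊢ [ b₀ a ]tc A ⟶ [ b ]tc A) →
    Q a b d)

⟨_⊢_⟩ : (Tm₁ → Tm₂ → List JFm) → (Tm₁ → Tm₂ → JFm) → Tm₁ → Tm₂ → Pf → Set
⟨ Γ ⊢ G ⟩ a b d = Γ a b ∣ d ⊢ G a b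

pure : ∀ {D} {Q : Tm₁ → Tm₂ → D → Set} → ∃[ d ] (∀ a b → Q a b d) → Realizable Q
-- No modal rule contributes here. The variables are fillers, harmless because normality constrains
-- only negative occurrences.
pure (d , m) j k = x 0 , (λ _ → y 0) , d , λ a b _ _ → m a b

mapᴿ : ∀ {D E} {Q : Tm₁ → Tm₂ → D → Set} {R : Tm₁ → Tm₂ → E → Set} →
  (∀ d → ∃[ e ] (∀ a b → Q a b d → R a b e)) → Realizable Q → Realizable R
mapᴿ f r j k with r j k
... | a₀ , b₀ , d , m = a₀ , b₀ , proj₁ (f d) , λ a b p q → proj₂ (f d) a b (m a b p q)

compose : Pf → Pf → Pf
compose j d = abs (shift j ∙ (shift d ∙ hyp zero))

⊢compose : ∀ {j d A B C} → [] ∣ j ⊢ B ⟶ C → [] ∣ d ⊢ A ⟶ B → [] ∣ compose j d ⊢ A ⟶ C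
⊢compose m n = lam (⊢shift m ∙ (⊢shift n ∙ hyp vz))

inlPf inrPf : Pf
inlPf = compose axm (proj₁ ∨-injˡ)
inrPf = compose axm (proj₁ ∨-injʳ)

inl₁ : ∀ {s t A} → [] ∣ inlPf ⊢ [ s ] A ⟶ [ s +₁ t ] A
inl₁ = ⊢compose (axm (v _ _ _)) (proj₂ ∨-injˡ)

inr₁ : ∀ {s t A} → [] ∣ inrPf ⊢ [ t ] A ⟶ [ s +₁ t ] A
inr₁ = ⊢compose (axm (v _ _ _)) (proj₂ ∨-injʳ)

inl₂ : ∀ {s t A} → [] ∣ inlPf ⊢ [ s ]tc A ⟶ [ s +₂ t ]tc A
inl₂ = ⊢compose (axm (x' _ _ _)) (proj₂ ∨-injˡ)

inr₂ : ∀ {s t A} → [] ∣ inrPf ⊢ [ t ]tc A ⟶ [ s +₂ t ]tc A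
inr₂ = ⊢compose (axm (x' _ _ _)) (proj₂ ∨-injʳ)

pair : ∀ {D E} {Q : Tm₁ → Tm₂ → D → Set} {R : Tm₁ → Tm₂ → E → Set} →
  Realizable Q → Realizable R →
  Realizable {D × E} (λ a b de → Q a b (proj₁ de) × R a b (proj₂ de))
pair q r j k with q (compose j inlPf) (compose k inlPf) | r (compose j inrPf) (compose k inrPf)
... | a₁ , b₁ , d , m | a₂ , b₂ , e , n =
  a₁ +₁ a₂ , (λ a → b₁ a +₂ b₂ a) , (d , e) , λ a b p q →
  m a b (⊢compose p inl₁) (⊢compose q inl₂) , n a b (⊢compose p inr₁) (⊢compose q inr₂)

-- The new term `t` becomes the left summand. It depends only on the premise's shape `d`, so it is
-- fixed before `a`.
emit₁ : ∀ {D Γ} {H : Tm₁ → Tm₂ → JFm} {Q : Tm₁ → Tm₂ → D → Set} →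
  (∀ d → Σ[ t ∈ Tm₁ ] ∃[ e ] (∀ a b → Q a b d → Γ a b ∣ e ⊢ [ t ] H a b)) →
  Realizable Q → Realizable ⟨ Γ ⊢ (λ a b → [ a ] H a b) ⟩
emit₁ f r j k with r (compose j inrPf) k
... | a₀ , b₀ , d , m with f d
... | t , e , n =
  t +₁ a₀ , b₀ , compose j inlPf ∙ e , λ a b p q →
  ⊢closed (⊢compose p inl₁) ∙ n a b (m a b (⊢compose p inr₁) q)

-- Here `t` may depend on `a`, as `ind` terms do; this is consistent because `a` is fixed before
-- `b`.
emit₂ : ∀ {D Γ} {H : Tm₁ → Tm₂ → JFm} {Q : Tm₁ → Tm₂ → D → Set} →
  (∀ d → Σ[ t ∈ (Tm₁ → Tm₂) ] ∃[ e ] (∀ a b → Q a b d → Γ a b ∣ e ⊢ [ t a ]tc H a b)) →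
  Realizable Q → Realizable ⟨ Γ ⊢ (λ a b → [ b ]tc H a b) ⟩
emit₂ f r j k with r j (compose k inrPf)
... | a₀ , b₀ , d , m with f d
... | t , e , n =
  a₀ , (λ a → t a +₂ b₀ a) , compose k inlPf ∙ e , λ a b p q →
  ⊢closed (⊢compose q inl₂) ∙ n a b (m a b p (⊢compose q inr₂))

Context : Seq → Tm₁ → Tm₂ → List JFm
Context s a b = map (hypo a b) s

Goal : Maybe (List Seq) → Tm₁ → Tm₂ → JFm
Goal Y a b = goal a b Y

χ-intro : ∀ {t Y} → t ∈ Y → ∃[ d ] ∀ a b → Context t a b ∣ d ⊢ χ a b Y
χ-intro {t} (here refl) = _ , λ a b →
  lam (exFalso (⊢applyHyps (hypo a b) t (λ m → ⊢shift (⊢hyp (hypo a b) m)) (hyp vz)))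
χ-intro (there m) with χ-intro m
... | _ , n = _ , λ a b → lam (⊢shift (n a b))

-- Since `t` yields `G`, the hypothesis `j¬ G` refutes the first disjunct, which leaves the
-- disjunction of the remaining ones.
χ-refute : ∀ Y {G : Tm₁ → Tm₂ → JFm} →
  (∀ {t} → t ∈ Y → Realizable ⟨ Context t ⊢ G ⟩) →
  Realizable ⟨ (λ a b → χ a b Y ∷ j¬ (G a b) ∷ []) ⊢ (λ _ _ → j⊥) ⟩
χ-refute []      f = pure (_ , λ a b → hyp vz)
χ-refute (t ∷ Y) f =
  mapᴿ (λ _ → _ , λ { a b (m , n) →
      ⊢closed (lam (lam n)) ∙ hyp (vs vz) ∙
      (hyp vz ∙ (⊢map (hypo a b) t (hyp (vs vz)) ∙ ⊢closed (⊢discharge (hypo a b) t m))) })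
    (pair (f (here refl)) (χ-refute Y (f ∘ there)))

χ-elim : ∀ Y {G : Tm₁ → Tm₂ → JFm} →
  (∀ {t} → t ∈ Y → Realizable ⟨ Context t ⊢ G ⟩) →
  Realizable ⟨ (λ _ _ → []) ⊢ (λ a b → χ a b Y ⟶ G a b) ⟩
χ-elim Y f =
  mapᴿ (λ _ → _ , λ a b m → lam (raa (⊢closed (lam (lam m)) ∙ hyp vz ∙ hyp (vs vz)))) (χ-refute Y f)

proveConclusion : ∀ {s B} → Realizable ⟨ Context ((true , B) ∷ s) ⊢ (λ _ _ → j⊥) ⟩ →
  Realizable ⟨ Context s ⊢ (λ a b → ρ a b true B) ⟩
proveConclusion = mapᴿ (λ _ → _ , λ a b → raa)

realizeLoop : ∀ {Y s t} → t ∈ Y → t ⊆ step s →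
  Realizable ⟨ Context s ⊢ (λ a b → [ a ] χ a b Y) ⟩
realizeLoop {s = s} t∈Y t⊆ =
  emit₁ {H = λ a b → χ a b _} (λ d → stepTerm s d , stepPf s d , λ a b → ⊢step s)
    (pure (_ , λ a b → ⊢weaken (hypo a b) t⊆ (proj₂ (χ-intro t∈Y) a b)))

realize : ∀ {Y s} → Derivable Y s → Realizable ⟨ Context s ⊢ Goal Y ⟩
realize (id⊢ m n) = pure (_ , λ a b → contradict (⊢hyp (hypo a b) n) (⊢hyp (hypo a b) m))
realize (⊥L m) = pure (_ , λ a b → exFalso (⊢hyp (hypo a b) m))
realize (⇒R m d) =
  -- The goal may be `[ a ] χ`, so its negation is assumed and the premise contradicts it.
  mapᴿ (λ _ → _ , λ a b n → raa
    (⊢shift (⊢hyp (hypo a b) m) ∙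
      lam (raa (hyp (vs (vs vz)) ∙
        (⊢shift (⊢shift (⊢shift (lam (lam n)))) ∙ hyp vz ∙ hyp (vs vz))))))
    (realize d)
realize (⇒L m d e) =
  mapᴿ (λ _ → _ , λ { a b (p , q) → raa
    (hyp vz ∙ (⊢shift (lam q) ∙
      (⊢shift (⊢hyp (hypo a b) m) ∙ raa (hyp (vs vz) ∙ (⊢shift (⊢shift (lam p)) ∙ hyp vz))))) })
    (pair (realize d) (realize e))
realize {s = s} (□R {B = B} m d) =
  mapᴿ (λ _ → _ , λ a b n → contradict (⊢hyp (hypo a b) m) n)
    (emit₁ {H = λ a b → ρ a b true B} (λ _ → _ , _ , λ a b n → ⊢step s n) (proveConclusion (realize d)))
realize {s = s} (□⁺R {B = B} m Z t∈Z t⊆ f g) =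
  mapᴿ (λ _ → _ , λ a b n → contradict (⊢hyp (hypo a b) m) n)
    -- With χ for the disjunction of `Z`, `p` proves `[ a ] χ`, `q` proves that χ implies `B`, and
    -- `r` that χ implies `[ a ] χ`. Axiom (ix) applied to `p` and the necessitated `r` justifies χ,
    -- and the necessitated `q` carries this over to `B`.
    (emit₂ {H = λ a b → ρ a b true B} (λ _ → _ , _ , λ { a b (p , q , r) →
        axm (vi _ _ _ _) ∙ ⊢closed (⊢necessitate q) ∙
        (axm (ix _ _ _) ∙ (⊢closed (proj₂ ∧-intro) ∙ p ∙ ⊢closed (⊢necessitate r))) })
      (pair (realizeLoop t∈Z t⊆)
        (pair (χ-elim Z (λ u∈Z → proveConclusion (realize (f u∈Z))))
          (χ-elim Z (λ u∈Z → realize (g u∈Z))))))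
realize (loop t∈Y t⊆) = realizeLoop t∈Y t⊆
realize (wk s⊆t d) = mapᴿ (λ _ → _ , λ a b → ⊢weaken (hypo a b) s⊆t) (realize d)
realize (drop d) = mapᴿ (λ _ → _ , λ a b → exFalso) (realize d)

-- Injective constant specifications

toProof : ∀ {d A} → [] ∣ d ⊢ A → J⁺Proof A
toProof (hyp ())
toProof (axm m) = ax m
toProof (cst m) = csax 0 m
toProof (m ∙ n) = mp (toProof n) (toProof m)

module ConstantSubstitution (r : Tm₂) where

  sub₁ : Tm₁ → Tm₁
  sub₂ : Tm₂ → Tm₂
  sub₁ (x n)    = x n
  sub₁ (s ·₁ t) = sub₁ s ·₁ sub₁ t
  sub₁ (head s) = head (sub₂ s)
  sub₁ (tail s) = tail (sub₂ s)
  sub₁ (s +₁ t) = sub₁ s +₁ sub₁ t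
  sub₂ (y n)     = y n
  sub₂ (c n)     = r
  sub₂ (s ·₂ t)  = sub₂ s ·₂ sub₂ t
  sub₂ (ind w s) = ind (sub₁ w) (sub₂ s)
  sub₂ (s +₂ t)  = sub₂ s +₂ sub₂ t

  sub : JFm → JFm
  sub (jvar n)    = jvar n
  sub j⊥          = j⊥
  sub (A ⟶ B)     = sub A ⟶ sub B
  sub ([ w ] A)   = [ sub₁ w ] sub A
  sub ([ s ]tc A) = [ sub₂ s ]tc sub A

  sub-axiom : ∀ {A} → AxJ₀ A → AxJ₀ (sub A)
  sub-axiom (i _ _)      = i _ _
  sub-axiom (ii _ _ _)   = ii _ _ _
  sub-axiom (iii _)      = iii _
  sub-axiom (iv _ _ _ _) = iv _ _ _ _
  sub-axiom (v _ _ _)    = v _ _ _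
  sub-axiom (vi _ _ _ _) = vi _ _ _ _
  sub-axiom (vii _ _)    = vii _ _
  sub-axiom (viii _ _)   = viii _ _
  sub-axiom (ix _ _ _)   = ix _ _ _
  sub-axiom (x' _ _ _)   = x' _ _ _

  -- Negative modalities carry variables, which the substitution fixes, so only the two positive
  -- realizers change.
  sub-ρ : ∀ {a b} p A → sub (ρ a b p A) ≡ ρ (sub₁ a) (sub₂ b) p A
  sub-ρ p     (var n)  = refl
  sub-ρ p     ⊥'       = refl
  sub-ρ p     (A ⇒ B)  = cong₂ _⟶_ (sub-ρ (not p) A) (sub-ρ p B)
  sub-ρ true  (□ n A)  = cong ([ _ ]_) (sub-ρ true A)
  sub-ρ false (□ n A)  = cong ([ _ ]_) (sub-ρ false A)
  sub-ρ true  (□⁺ n A) = cong ([ _ ]tc_) (sub-ρ true A)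
  sub-ρ false (□⁺ n A) = cong ([ _ ]tc_) (sub-ρ false A)

constants : ℕ → Tm₂
-- There is no empty sum, so `c 0` serves as filler.
constants zero    = c 0
constants (suc m) = c m +₂ constants m

-- The injections into sums use no constant axioms, so only the one for `c j` is recorded.
constantProof : ∀ m {j A} → j < m → AxJ₀ A →
  Σ[ π ∈ J⁺Proof ([ constants m ]tc A) ] cs π ≡ (j , A) ∷ []
constantProof (suc m) {j} j<1+m α with m<1+n⇒m<n∨m≡n j<1+m
... | inj₂ refl = mp (csax j α) (toProof inl₂) , refl
... | inj₁ j<m with constantProof m j<m α
... | π , e = mp π (toProof inr₂) , trans (++-identityʳ (cs π)) e

leaves : ∀ {A} → J⁺Proof A → ℕ
leaves (ax _)     = 0
leaves (csax _ _) = 1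
leaves (mp π σ)   = leaves π + leaves σ

-- Replacing every constant by the sum of c 0, …, c (N - 1) keeps axioms axioms, and
-- lets the constant axioms of a proof be justified by pairwise distinct constants.
module _ (N : ℕ) where
  open ConstantSubstitution (constants N)

  renumber : ∀ {A} (π : J⁺Proof A) k → k + leaves π ≤ N →
    Σ[ σ ∈ J⁺Proof (sub A) ] Fresh id id k (k + leaves π) (map proj₁ (cs σ))
  renumber (ax α) k _ = ax (sub-axiom α) , fresh-[] id id
  renumber (csax _ α) k k<N rewrite +-comm k 1 with constantProof N k<N (sub-axiom α)
  ... | σ , e = σ , subst (Fresh id id k (suc k)) (cong (map proj₁) (sym e))
    (fresh-∷ id id ≤-refl (fresh-[] id id))
  renumber (mp π ρ) k h rewrite sym (+-assoc k (leaves π) (leaves ρ))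
    with renumber π k (≤-trans (m≤m+n _ _) h) | renumber ρ (k + leaves π) h
  ... | π' , p | ρ' , q =
    mp π' ρ' , subst (Fresh id id k _) (sym (map-++ proj₁ (cs π') (cs ρ')))
                 (fresh-++ id id (m≤m+n _ _) (m≤m+n _ _) p q)

unique⇒functional : ∀ {A B : Set} (l : List (A × B)) → Unique (map proj₁ l) →
  ∀ {k a b} → (k , a) ∈ l → (k , b) ∈ l → a ≡ b
unique⇒functional (_ ∷ l) (_ ∷ u) (here refl) (here refl) = refl
unique⇒functional (_ ∷ l) (n ∷ u) (here refl) (there q)   = ⊥-elim (All.lookup n (∈-map⁺ proj₁ q) refl)
unique⇒functional (_ ∷ l) (n ∷ u) (there p)   (here refl) = ⊥-elim (All.lookup n (∈-map⁺ proj₁ p) refl)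
unique⇒functional (_ ∷ l) (_ ∷ u) (there p)   (there q)   = unique⇒functional l u p q

derivable⇒realization : ∀ A → Derivable nothing ((true , label 0 A) ∷ []) →
  Σ[ B ∈ JFm ] (Realization A B × Normal B × Σ[ π ∈ J⁺Proof B ] Injective π)
-- The total sums are the collected summands themselves, so both injections are the identity.
derivable⇒realization A d with realize d (abs (hyp zero)) (abs (hyp zero))
... | a , b , e , m = B , realization , ρ-normal (sub₁ a) (sub₂ (b a)) A , injective
  where
  π : J⁺Proof (ρ a (b a) true (label 0 A))
  π = toProof (raa (m a (b a) (lam (hyp vz)) (lam (hyp vz))))
  -- One constant for each use of a constant axiom in `π`.
  open ConstantSubstitution (constants (leaves π))
  B : JFm
  B = ρ (sub₁ a) (sub₂ (b a)) true (label 0 A)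
  realization : Realization A B
  realization = subst (λ C → Realization C B) (forget-label 0 A)
    (ρ-realization (sub₁ a) (sub₂ (b a)) true (label 0 A))
  injective : Σ[ σ ∈ J⁺Proof B ] Injective σ
  injective with renumber (leaves π) π 0 ≤-refl
  ... | σ , _ , u = subst (λ C → Σ[ σ ∈ J⁺Proof C ] Injective σ) (sub-ρ true (label 0 A))
    (σ , λ _ _ _ → unique⇒functional (cs σ) u)

-- Kripke semantics

module Kripke {W : Set} (R : W → W → Set) (V : ℕ → W → Set)
  (V-stable : ∀ {n w} → ¬ ¬ V n w → V n w) where

  infix 4 _⊩_
  _⊩_ : W → Fm → Set
  w ⊩ var n = V n w
  w ⊩ ⊥'    = ⊥
  w ⊩ A ⇒ B = w ⊩ A → w ⊩ B
  w ⊩ □ A   = ∀ {u} → R w u → u ⊩ A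
  w ⊩ □⁺ A  = ∀ {u} → TransClosure R w u → u ⊩ A

  ⊩-stable : ∀ A {w} → ¬ ¬ (w ⊩ A) → w ⊩ A
  ⊩-stable (var n) h   = V-stable h
  ⊩-stable ⊥'      h   = h id
  ⊩-stable (A ⇒ B) h p = ⊩-stable B (λ k → h (λ f → k (f p)))
  ⊩-stable (□ A)   h r = ⊩-stable A (λ k → h (λ f → k (f r)))
  ⊩-stable (□⁺ A)  h r = ⊩-stable A (λ k → h (λ f → k (f r)))

  induction : ∀ A {w} → w ⊩ □ A → w ⊩ □⁺ (A ⇒ □ A) → w ⊩ □⁺ A
  induction A h k [ r ]⁺  = h r
  induction A h k (r ∷ p) = induction A (k [ r ]⁺ (h r)) (k ∘ (r ∷_)) p

  sound : ∀ {A} → K⁺⊢ A → ∀ w → w ⊩ A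
  sound (ax1 A B)   w p _     = p
  sound (ax2 A B C) w f g p   = f p (g p)
  sound (ax3 A)     w         = ⊩-stable A
  sound (axK A B)   w f g r   = f r (g r)
  sound (axK⁺ A B)  w f g r   = f r (g r)
  sound (axC1 A)    w f r     = f [ r ]⁺
  sound (axC2 A)    w f r p   = f (r ∷ p)
  sound (axInd A)   w h r     = ⊩-stable A (λ k → h (λ f g → k (induction A f g r)))
  sound (mp p q)    w         = sound q w (sound p w)
  sound (nec p)     w {u} _   = sound p u

-- Proof search

_≟_ : DecidableEquality LFm
var m   ≟ var n with m ℕ.≟ n
... | yes refl = yes refl
... | no m≢n   = no λ { refl → m≢n refl }
⊥'      ≟ ⊥' = yes refl
(A ⇒ B) ≟ (C ⇒ D) with A ≟ C | B ≟ D
... | yes refl | yes refl = yes refl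
... | no A≢C   | _        = no λ { refl → A≢C refl }
... | _        | no B≢D   = no λ { refl → B≢D refl }
□ m A   ≟ □ n B with m ℕ.≟ n | A ≟ B
... | yes refl | yes refl = yes refl
... | no m≢n   | _        = no λ { refl → m≢n refl }
... | _        | no A≢B   = no λ { refl → A≢B refl }
□⁺ m A  ≟ □⁺ n B with m ℕ.≟ n | A ≟ B
... | yes refl | yes refl = yes refl
... | no m≢n   | _        = no λ { refl → m≢n refl }
... | _        | no A≢B   = no λ { refl → A≢B refl }
var _   ≟ ⊥'      = no λ ()
var _   ≟ (_ ⇒ _) = no λ ()
var _   ≟ □ _ _   = no λ ()
var _   ≟ □⁺ _ _  = no λ ()
⊥'      ≟ var _   = no λ ()
⊥'      ≟ (_ ⇒ _) = no λ ()
⊥'      ≟ □ _ _   = no λ ()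
⊥'      ≟ □⁺ _ _  = no λ ()
(_ ⇒ _) ≟ var _   = no λ ()
(_ ⇒ _) ≟ ⊥'      = no λ ()
(_ ⇒ _) ≟ □ _ _   = no λ ()
(_ ⇒ _) ≟ □⁺ _ _  = no λ ()
□ _ _   ≟ var _   = no λ ()
□ _ _   ≟ ⊥'      = no λ ()
□ _ _   ≟ (_ ⇒ _) = no λ ()
□ _ _   ≟ □⁺ _ _  = no λ ()
□⁺ _ _  ≟ var _   = no λ ()
□⁺ _ _  ≟ ⊥'      = no λ ()
□⁺ _ _  ≟ (_ ⇒ _) = no λ ()
□⁺ _ _  ≟ □ _ _   = no λ ()

_≟ˢ_ : DecidableEquality SF
_≟ˢ_ = ≡-dec Bool._≟_ _≟_

open import Data.List.Membership.DecPropositional _≟ˢ_ using (_∈?_; _∉?_)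
open import Data.List.Membership.DecPropositional (List.≡-dec _≟ˢ_)
  using () renaming (_∈?_ to _∈ˢ?_; _∉?_ to _∉ˢ?_)
open import Data.List.Relation.Binary.Subset.DecPropositional _≟ˢ_ using (_⊆?_)

-- Signed subformulas and finite lists

subformulas : Bool → LFm → List SF
subformulas p (var n)  = (p , var n) ∷ []
subformulas p ⊥'       = (p , ⊥') ∷ []
subformulas p (A ⇒ B)  = (p , A ⇒ B) ∷ subformulas (not p) A ++ subformulas p B
subformulas p (□ n A)  = (p , □ n A) ∷ subformulas p A
subformulas p (□⁺ n A) = (p , □⁺ n A) ∷ subformulas p A

self∈ : ∀ p A → (p , A) ∈ subformulas p A
self∈ p (var n)  = here refl
self∈ p ⊥'       = here refl
self∈ p (A ⇒ B)  = here refl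
self∈ p (□ n A)  = here refl
self∈ p (□⁺ n A) = here refl

subformulas-trans : ∀ p A {q B} → (q , B) ∈ subformulas p A → subformulas q B ⊆ subformulas p A
subformulas-trans p (var n)  (here refl) m = m
subformulas-trans p ⊥'       (here refl) m = m
subformulas-trans p (A ⇒ B)  (here refl) m = m
subformulas-trans p (A ⇒ B)  (there k)   m with ∈-++⁻ (subformulas (not p) A) k
... | inj₁ k' = there (∈-++⁺ˡ (subformulas-trans (not p) A k' m))
... | inj₂ k' = there (∈-++⁺ʳ _ (subformulas-trans p B k' m))
subformulas-trans p (□ n A)  (here refl) m = m
subformulas-trans p (□ n A)  (there k)   m = there (subformulas-trans p A k m)
subformulas-trans p (□⁺ n A) (here refl) m = m
subformulas-trans p (□⁺ n A) (there k)   m = there (subformulas-trans p A k m)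

sublists : {T : Set} → List T → List (List T)
sublists []      = [] ∷ []
sublists (a ∷ l) = sublists l ++ map (a ∷_) (sublists l)

sublists⇒⊆ : {T : Set} (l : List T) {s : List T} → s ∈ sublists l → s ⊆ l
sublists⇒⊆ [] (here refl) m = m
sublists⇒⊆ (a ∷ l) k m with ∈-++⁻ (sublists l) k
... | inj₁ k' = there (sublists⇒⊆ l k' m)
... | inj₂ k' with ∈-map⁻ (a ∷_) k'
sublists⇒⊆ (a ∷ l) k (here refl) | inj₂ k' | s , s∈ , refl = here refl
sublists⇒⊆ (a ∷ l) k (there m)   | inj₂ k' | s , s∈ , refl = there (sublists⇒⊆ l s∈ m)

module _ {T : Set} {P : T → Set} (P? : Decidable P) where

  filter∈sublists : ∀ l → filter P? l ∈ sublists l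
  filter∈sublists []      = here refl
  filter∈sublists (a ∷ l) with P? a
  ... | yes _ = ∈-++⁺ʳ _ (∈-map⁺ (a ∷_) (filter∈sublists l))
  ... | no  _ = ∈-++⁺ˡ (filter∈sublists l)

  module _ {Q : T → Set} (Q? : Decidable Q) (P⇒Q : ∀ {a} → P a → Q a) where

    filter-mono : ∀ l → length (filter P? l) ≤ length (filter Q? l)
    filter-mono []      = z≤n
    filter-mono (a ∷ l) with P? a | Q? a
    ... | yes _ | yes _ = s≤s (filter-mono l)
    ... | yes p | no ¬q = ⊥-elim (¬q (P⇒Q p))
    ... | no _  | yes _ = m≤n⇒m≤1+n (filter-mono l)
    ... | no _  | no _  = filter-mono l

    filter-mono-< : ∀ {a} l → a ∈ l → ¬ P a → Q a → length (filter P? l) < length (filter Q? l)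
    filter-mono-< (a ∷ l) (here refl) ¬p q with P? a | Q? a
    ... | yes p | _     = ⊥-elim (¬p p)
    ... | no _  | yes _ = s≤s (filter-mono l)
    ... | no _  | no ¬q = ⊥-elim (¬q q)
    filter-mono-< (b ∷ l) (there m)   ¬p q with P? b | Q? b
    ... | yes _ | yes _ = s≤s (filter-mono-< l m ¬p q)
    ... | yes p | no ¬q = ⊥-elim (¬q (P⇒Q p))
    ... | no _  | yes _ = m≤n⇒m≤1+n (filter-mono-< l m ¬p q)
    ... | no _  | no _  = filter-mono-< l m ¬p q

allOrNone : {T A : Set} {B : T → Set} (l : List T) → (∀ {a} → a ∈ l → A ⊎ B a) →
  A ⊎ (∀ {a} → a ∈ l → B a)
allOrNone []      f = inj₂ λ ()
allOrNone (a ∷ l) f with f (here refl) | allOrNone l (f ∘ there)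
... | inj₁ p | _      = inj₁ p
... | inj₂ _ | inj₁ p = inj₁ p
... | inj₂ q | inj₂ g = inj₂ λ { (here refl) → q ; (there m) → g m }

-- Greedy closure of a finite list

module Closure {T : Set} (U : List T) (Q : T → Set) (G : List T → T → Set)
  (decide : ∀ {X} → All Q X → ∀ {t} → t ∈ U → Q t ⊎ G X t) where

  Extraction : List T → Set
  Extraction l = Σ[ t ∈ T ] Σ[ l' ∈ List T ]
    Q t × l' ⊆ l × length l ≡ suc (length l') × (∀ {u} → u ∈ l → u ≡ t ⊎ u ∈ l')

  extract : ∀ {t} l → t ∈ l → Q t → Extraction l
  extract (t ∷ l) (here refl) q = t , l , q , there , refl ,
    λ { (here e) → inj₁ e ; (there m) → inj₂ m }
  extract (a ∷ l) (there m)   q with extract l m q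
  ... | t , l' , q' , sub , e , f = t , a ∷ l' , q' ,
    (λ { (here e) → here e ; (there n) → there (sub n) }) , cong suc e ,
    λ { (here e) → inj₂ (here e) ; (there n) → [ inj₁ , inj₂ ∘ there ]′ (f n) }

  Closed : Set
  Closed = Σ[ X ∈ List T ] All Q X × (∀ {t} → t ∈ U → t ∈ X ⊎ G X t)

  -- The list `l` holds the outstanding elements. One satisfying `Q` moves to `X` and everything
  -- left is decided again; when none is found, `G` holds of all of `l` for the same final `X`.
  iterate : ∀ n {X} l → length l ≡ n → l ⊆ U → All Q X → (∀ {t} → t ∈ U → t ∈ X ⊎ t ∈ l) → Closed
  iterate n {X} l e l⊆U q cover
    with allOrNone l (λ {t} m → [ (λ p → inj₁ (extract l m p)) , inj₂ ]′ (decide q (l⊆U m)))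
  ... | inj₂ g = X , q , λ m → [ inj₁ , inj₂ ∘ g ]′ (cover m)
  iterate zero    []      e l⊆U q cover | inj₁ (_ , _ , _ , _ , () , _)
  iterate (suc n) {X} l   e l⊆U q cover | inj₁ (t , l' , p , sub , e' , f) =
    iterate n l' (suc-injective (trans (sym e') e)) (l⊆U ∘ sub) (p ∷ q)
      (λ m → [ inj₁ ∘ there , (λ k → [ inj₁ ∘ here , inj₂ ]′ (f k)) ]′ (cover m))

  closed : Closed
  closed = iterate (length U) U refl id [] inj₂

-- The clauses for variables and falsum also exclude sequents closed by `id⊢` or `⊥L`.
SaturatedAt : Seq → SF → Set
SaturatedAt s (false , var n) = (true , var n) ∉ s
SaturatedAt s (false , ⊥')    = ⊥
SaturatedAt s (false , B ⇒ C) = (true , B) ∈ s ⊎ (false , C) ∈ s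
SaturatedAt s (true , B ⇒ C)  = (false , B) ∈ s × (true , C) ∈ s
SaturatedAt s _               = ⊤

saturatedAt? : ∀ s → Decidable (SaturatedAt s)
saturatedAt? s (false , var n)  = (true , var n) ∉? s
saturatedAt? s (false , ⊥')     = no id
saturatedAt? s (false , B ⇒ C)  = ((true , B) ∈? s) ⊎-dec ((false , C) ∈? s)
saturatedAt? s (false , □ _ _)  = yes tt
saturatedAt? s (false , □⁺ _ _) = yes tt
saturatedAt? s (true , var _)   = yes tt
saturatedAt? s (true , ⊥')      = yes tt
saturatedAt? s (true , B ⇒ C)   = ((false , B) ∈? s) ×-dec ((true , C) ∈? s)
saturatedAt? s (true , □ _ _)   = yes tt
saturatedAt? s (true , □⁺ _ _)  = yes tt

Saturated : Seq → Set
Saturated s = All (SaturatedAt s) s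

saturated? : Decidable Saturated
saturated? s = all? (saturatedAt? s) s

next⊆step : ∀ {f s} → f ∈ s → next f ⊆ step s
next⊆step (here refl)       m = ∈-++⁺ˡ m
next⊆step {s = g ∷ s} (there k) m = ∈-++⁺ʳ (next g) (next⊆step k m)

-- Saturation within the subformula closure

module Search (A₀ : LFm) where

  Cl : Seq
  Cl = subformulas true A₀

  immediate : ∀ {p A} → (p , A) ∈ Cl → subformulas p A ⊆ Cl
  immediate = subformulas-trans true A₀

  ⇒-closedˡ : ∀ {p B C} → (p , B ⇒ C) ∈ Cl → (not p , B) ∈ Cl
  ⇒-closedˡ m = immediate m (there (∈-++⁺ˡ (self∈ _ _)))

  ⇒-closedʳ : ∀ {p B C} → (p , B ⇒ C) ∈ Cl → (p , C) ∈ Cl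
  ⇒-closedʳ {p} {B} m = immediate m (there (∈-++⁺ʳ (subformulas (not p) B) (self∈ _ _)))

  □-closed : ∀ {p n B} → (p , □ n B) ∈ Cl → (p , B) ∈ Cl
  □-closed m = immediate m (there (self∈ _ _))

  □⁺-closed : ∀ {p n B} → (p , □⁺ n B) ∈ Cl → (p , B) ∈ Cl
  □⁺-closed m = immediate m (there (self∈ _ _))

  ∷-closed : ∀ {f s} → f ∈ Cl → s ⊆ Cl → f ∷ s ⊆ Cl
  ∷-closed m sub (here refl) = m
  ∷-closed m sub (there n)   = sub n

  next-closed : ∀ f → f ∈ Cl → next f ⊆ Cl
  next-closed (false , □ _ _)  m (here refl)         = □-closed m
  next-closed (false , □⁺ _ _) m (here refl)         = □⁺-closed m
  next-closed (false , □⁺ _ _) m (there (here refl)) = m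
  next-closed (false , var _)  m ()
  next-closed (false , ⊥')     m ()
  next-closed (false , _ ⇒ _)  m ()
  next-closed (true , var _)   m ()
  next-closed (true , ⊥')      m ()
  next-closed (true , _ ⇒ _)   m ()
  next-closed (true , □ _ _)   m ()
  next-closed (true , □⁺ _ _)  m ()

  step-closed : ∀ s → s ⊆ Cl → step s ⊆ Cl
  step-closed (f ∷ s) sub m with ∈-++⁻ (next f) m
  ... | inj₁ k = next-closed f (sub (here refl)) k
  ... | inj₂ k = step-closed s (sub ∘ there) k

  U : List Seq
  U = sublists Cl

  U⇒⊆ : ∀ {s} → s ∈ U → s ⊆ Cl
  U⇒⊆ = sublists⇒⊆ Cl

  -- The canonical representative in `U` of the set of members of `s` that lie in `Cl`.
  norm : Seq → Seq
  norm s = filter (_∈? s) Cl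

  norm∈U : ∀ s → norm s ∈ U
  norm∈U s = filter∈sublists (_∈? s) Cl

  norm⊆ : ∀ s → norm s ⊆ s
  norm⊆ s m = proj₂ (∈-filter⁻ (_∈? s) {xs = Cl} m)

  ⊆norm : ∀ {s} → s ⊆ Cl → s ⊆ norm s
  ⊆norm {s} sub m = ∈-filter⁺ (_∈? s) (sub m) m

  missing : Seq → ℕ
  missing s = length (filter (_∉? s) Cl)

  missing-< : ∀ {s t f} → s ⊆ t → f ∈ Cl → f ∈ t → f ∉ s → missing t < missing s
  missing-< {s} {t} sub f∈Cl f∈t f∉s =
    filter-mono-< (_∉? t) (_∉? s) (λ ∉t ∈s → ∉t (sub ∈s)) Cl f∈Cl (λ ∉t → ∉t f∈t) f∉s

  Saturations : Seq → (Seq → Set) → Set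
  Saturations s P = ∀ t → t ∈ U → Saturated t → s ⊆ t → P t

  -- Each backward propositional step adds a new member of `Cl`, so `missing` decreases until the
  -- sequent is saturated or closed by an axiom.
  saturateAcc : ∀ {Y s} → s ∈ U → Acc _<_ (missing s) → Saturations s (Derivable Y) → Derivable Y s
  saturateAcc {Y} {s} s∈U (acc rs) h with saturated? s
  ... | yes sat = h s s∈U sat id
  ... | no ¬sat = expand (find (All.¬All⇒Any¬ (saturatedAt? s) s ¬sat))
    where
    grow : ∀ {f} r → r ⊆ Cl → f ∈ r → f ∉ s → Derivable Y (r ++ s)
    grow {f} r r⊆Cl f∈r f∉s =
      wk (norm⊆ (r ++ s)) (saturateAcc (norm∈U (r ++ s))
        (rs (missing-< s⊆norm (r⊆Cl f∈r) (r⊆norm f∈r) f∉s))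
        (λ t t∈U sat sub → h t t∈U sat (sub ∘ s⊆norm)))
      where
      r++s⊆norm : r ++ s ⊆ norm (r ++ s)
      r++s⊆norm = ⊆norm λ m → [ r⊆Cl , U⇒⊆ s∈U ]′ (∈-++⁻ r m)
      r⊆norm : r ⊆ norm (r ++ s)
      r⊆norm m = r++s⊆norm (∈-++⁺ˡ m)
      s⊆norm : s ⊆ norm (r ++ s)
      s⊆norm m = r++s⊆norm (∈-++⁺ʳ r m)
    none : [] ⊆ Cl
    none ()
    expand : (Σ[ f ∈ SF ] f ∈ s × ¬ SaturatedAt s f) → Derivable Y s
    expand ((false , var n) , m , ¬f) with (true , var n) ∈? s
    ... | yes k = id⊢ m k
    ... | no ¬k = ⊥-elim (¬f ¬k)
    expand ((false , ⊥') , m , ¬f) = ⊥L m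
    expand ((false , B ⇒ C) , m , ¬f) =
      ⇒L m
        (grow ((true , B) ∷ []) (∷-closed (⇒-closedˡ (U⇒⊆ s∈U m)) none) (here refl) (¬f ∘ inj₁))
        (grow ((false , C) ∷ []) (∷-closed (⇒-closedʳ (U⇒⊆ s∈U m)) none) (here refl) (¬f ∘ inj₂))
    expand ((false , □ _ _) , m , ¬f)  = ⊥-elim (¬f tt)
    expand ((false , □⁺ _ _) , m , ¬f) = ⊥-elim (¬f tt)
    expand ((true , var n) , m , ¬f)   = ⊥-elim (¬f tt)
    expand ((true , ⊥') , m , ¬f)      = ⊥-elim (¬f tt)
    expand ((true , B ⇒ C) , m , ¬f) with (false , B) ∈? s
    -- Whichever of the two added formulas is new witnesses the decrease.
    ... | no B∉s  = ⇒R m (grow _ both (here refl) B∉s)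
      where both = ∷-closed (⇒-closedˡ (U⇒⊆ s∈U m)) (∷-closed (⇒-closedʳ (U⇒⊆ s∈U m)) none)
    ... | yes B∈s = ⇒R m (grow _ both (there (here refl)) (λ C∈s → ¬f (B∈s , C∈s)))
      where both = ∷-closed (⇒-closedˡ (U⇒⊆ s∈U m)) (∷-closed (⇒-closedʳ (U⇒⊆ s∈U m)) none)
    expand ((true , □ _ _) , m , ¬f)   = ⊥-elim (¬f tt)
    expand ((true , □⁺ _ _) , m , ¬f)  = ⊥-elim (¬f tt)

  saturate : ∀ {Y s} → s ⊆ Cl → Saturations s (Derivable Y) → Derivable Y s
  saturate {s = s} sub h =
    wk (norm⊆ s) (saturateAcc (norm∈U s) (<-wellFounded _)
      (λ t t∈U sat sub' → h t t∈U sat (sub' ∘ ⊆norm sub)))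

  -- Worlds, escaping sequents and clusters

  module _ (X : List Seq) where

    World : Seq → Set
    World s = Σ[ t ∈ Seq ] t ∈ U × Saturated t × s ⊆ t × t ∉ X

    world? : ∀ s → Saturations s (_∈ X) ⊎ World s
    world? s with any? (λ t → saturated? t ×-dec s ⊆? t ×-dec t ∉ˢ? X) U
    ... | yes p = inj₂ (find p)
    ... | no ¬p = inj₁ λ t t∈U sat sub →
      decidable-stable (t ∈ˢ? X) (λ t∉X → ¬p (lose t∈U (sat , sub , t∉X)))

    -- A finite path of worlds outside `X`, starting above `s` and ending in one with conclusion
    -- `B`.
    data Escapes (B : LFm) (s : Seq) : Set where
      here  : World ((true , B) ∷ s) → Escapes B s
      there : ((t , _) : World s) → Escapes B (norm (step t)) → Escapes B s

    -- For a modal conclusion, the worlds needed to falsify it exist outside `X`.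
    Irrefutable : SF → Seq → Set
    Irrefutable (true , □ _ B)  s = World ((true , B) ∷ step s)
    Irrefutable (true , □⁺ _ B) s = Escapes B (norm (step s))
    Irrefutable _               s = ⊤

  module Cluster {X : List Seq} (X-derivable : ∀ {s} → s ∈ X → Saturated s → Derivable nothing s)
    {B : LFm} (B∈Cl : (true , B) ∈ Cl) where

    Confined : List Seq → Seq → Set
    Confined E s = Saturations ((true , B) ∷ s) (_∈ X) ×
      Saturations s (λ t → t ∈ X ⊎ norm (step t) ∉ E)

    confined? : ∀ {E} → All (Escapes X B) E → ∀ {s} → s ∈ U → Escapes X B s ⊎ Confined E s
    confined? {E} esc {s} _ with world? X ((true , B) ∷ s)
    ... | inj₂ w = inj₁ (here w)
    ... | inj₁ h with any? (λ t → (saturated? t ×-dec s ⊆? t ×-dec t ∉ˢ? X) ×-dec norm (step t) ∈ˢ? E) U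
    ... | yes p with find p
    ...   | t , t∈U , (sat , sub , t∉X) , m = inj₁ (there (t , t∈U , sat , sub , t∉X) (All.lookup esc m))
    confined? {E} esc {s} _ | inj₁ h | no ¬p = inj₂ (h , g)
      where
      g : Saturations s (λ t → t ∈ X ⊎ norm (step t) ∉ E)
      g t t∈U sat sub with t ∈ˢ? X
      ... | yes t∈X = inj₁ t∈X
      ... | no t∉X  = inj₂ λ m → ¬p (lose t∈U ((sat , sub , t∉X) , m))

    open Closure U (Escapes X B) Confined confined? using (closed)

    E : List Seq
    E = proj₁ closed

    -- The sequents not found to escape form the cluster: being confined, they satisfy both families
    -- of premises of `□⁺R`.
    Z : List Seq
    Z = filter (_∉ˢ? E) U

    Z⇒confined : ∀ {s} → s ∈ Z → s ∈ U × Confined E s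
    Z⇒confined m with ∈-filter⁻ (_∉ˢ? E) {xs = U} m
    ... | s∈U , s∉E with proj₂ (proj₂ closed) s∈U
    ... | inj₁ s∈E = ⊥-elim (s∉E s∈E)
    ... | inj₂ conf = s∈U , conf

    escapes? : ∀ {s} → s ∈ U → Escapes X B s ⊎ s ∈ Z
    escapes? {s} s∈U with s ∈ˢ? E
    ... | yes s∈E = inj₁ (All.lookup (proj₁ (proj₂ closed)) s∈E)
    ... | no s∉E  = inj₂ (∈-filter⁺ (_∉ˢ? E) s∈U s∉E)

    Z⇒B : ∀ {s} → s ∈ Z → Derivable nothing ((true , B) ∷ s)
    Z⇒B m with Z⇒confined m
    ... | s∈U , h , _ = saturate (∷-closed B∈Cl (U⇒⊆ s∈U))
      (λ t t∈U sat sub → X-derivable (h t t∈U sat sub) sat)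

    Z⇒Z : ∀ {s} → s ∈ Z → Derivable (just Z) s
    Z⇒Z m with Z⇒confined m
    ... | s∈U , _ , g = saturate (U⇒⊆ s∈U) λ t t∈U sat sub →
      [ (λ t∈X → drop (X-derivable t∈X sat))
      , (λ t∉E → loop (∈-filter⁺ (_∉ˢ? E) (norm∈U (step t)) t∉E) (norm⊆ (step t))) ]′
      (g t t∈U sat sub)

  -- Vacuous for the unsaturated members of `U`, so these enter `X` harmlessly.
  SaturatedDerivable : Seq → Set
  SaturatedDerivable s = Saturated s → Derivable nothing s

  -- A modal conclusion that lacks falsifying worlds makes `□R`, or `□⁺R` with the cluster `Z`,
  -- applicable.
  derivable? : ∀ {X} → All SaturatedDerivable X → ∀ {s} → s ∈ U →
    SaturatedDerivable s ⊎ (∀ {f} → f ∈ s → Irrefutable X f s)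
  derivable? {X} der {s} s∈U = allOrNone s one
    where
    X-derivable : ∀ {t} → t ∈ X → Saturated t → Derivable nothing t
    X-derivable = All.lookup der
    one : ∀ {f} → f ∈ s → SaturatedDerivable s ⊎ Irrefutable X f s
    one {false , var _}  m = inj₂ tt
    one {false , ⊥'}     m = inj₂ tt
    one {false , _ ⇒ _}  m = inj₂ tt
    one {false , □ _ _}  m = inj₂ tt
    one {false , □⁺ _ _} m = inj₂ tt
    one {true , var _}   m = inj₂ tt
    one {true , ⊥'}      m = inj₂ tt
    one {true , _ ⇒ _}   m = inj₂ tt
    one {true , □ _ B}   m with world? X ((true , B) ∷ step s)
    ... | inj₂ w = inj₂ w
    ... | inj₁ h = inj₁ λ _ → □R m
      (saturate (∷-closed (□-closed (U⇒⊆ s∈U m)) (step-closed s (U⇒⊆ s∈U)))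
        (λ t t∈U sat sub → X-derivable (h t t∈U sat sub) sat))
    one {true , □⁺ _ B}  m with escapes? (norm∈U (step s))
      where open Cluster X-derivable (□⁺-closed (U⇒⊆ s∈U m))
    ... | inj₁ e = inj₂ e
    ... | inj₂ k = inj₁ λ _ → □⁺R m Z k (norm⊆ (step s)) Z⇒B Z⇒Z
      where open Cluster X-derivable (□⁺-closed (U⇒⊆ s∈U m))

  -- The countermodel

  open Closure U SaturatedDerivable (λ X s → ∀ {f} → f ∈ s → Irrefutable X f s) derivable?
    using (closed)

  X : List Seq
  X = proj₁ closed

  W : Set
  W = World X []

  _⟶ʷ_ : W → W → Set
  (s , _) ⟶ʷ (t , _) = step s ⊆ t

  -- A variable holds unless it is a conclusion; being a negation, this is stable.
  open Kripke _⟶ʷ_ (λ n (s , _) → (true , var n) ∉ s) (λ h m → h (λ k → k m))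

  world : ∀ {s} → World X s → W
  world (t , t∈U , sat , _ , t∉X) = t , t∈U , sat , (λ ()) , t∉X

  irrefutable : ((s , _) : W) → ∀ {f} → f ∈ s → Irrefutable X f s
  irrefutable (s , s∈U , _ , _ , s∉X) with proj₂ (proj₂ closed) s∈U
  ... | inj₁ s∈X = ⊥-elim (s∉X s∈X)
  ... | inj₂ g   = g

  saturatedAt : ((s , _) : W) → ∀ {f} → f ∈ s → SaturatedAt s f
  saturatedAt (s , _ , sat , _) = All.lookup sat

  -- The inclusion in place of an equality absorbs the passage from `step` to `norm`.
  escape : ∀ {B s} → Escapes X B s → ∀ (w : W) → step (proj₁ w) ⊆ s →
    Σ[ u ∈ W ] TransClosure _⟶ʷ_ w u × (true , B) ∈ proj₁ u
  escape (here a) w sub =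
    world a , [ (λ m → proj₁ (proj₂ (proj₂ (proj₂ a))) (there (sub m))) ]⁺ ,
    proj₁ (proj₂ (proj₂ (proj₂ a))) (here refl)
  escape (there a@(t , t∈U , _ , s⊆t , _) e) w sub
    with escape e (world a) (⊆norm (step-closed t (U⇒⊆ t∈U)))
  ... | u , p , m = u , (λ k → s⊆t (sub k)) ∷ p , m

  persists : ∀ {w u : W} {n B} → TransClosure _⟶ʷ_ w u →
    (false , □⁺ n B) ∈ proj₁ w → (false , B) ∈ proj₁ u
  persists [ r ]⁺  m = r (next⊆step m (here refl))
  persists (_∷_ {y = u} r p) m = persists {w = u} p (r (next⊆step m (there (here refl))))

  -- Truth lemma. Saturation handles implications, `step` transports modal hypotheses, and
  -- `irrefutable` supplies the worlds that falsify modal conclusions.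
  forces  : ∀ B (w : W) → (false , B) ∈ proj₁ w → w ⊩ forget B
  refutes : ∀ B (w : W) → (true , B) ∈ proj₁ w → ¬ (w ⊩ forget B)
  forces (var n)  w m = saturatedAt w m
  forces ⊥'       w m = saturatedAt w m
  forces (B ⇒ C)  w m with saturatedAt w m
  ... | inj₁ k = λ p → ⊥-elim (refutes B w k p)
  ... | inj₂ k = λ _ → forces C w k
  forces (□ n B)  w m {u} r = forces B u (r (next⊆step m (here refl)))
  forces (□⁺ n B) w m {u} p = forces B u (persists {w} {u} p m)
  refutes (var n)  w m h = h m
  refutes ⊥'       w m h = h
  refutes (B ⇒ C)  w m h with saturatedAt w m
  ... | k , l = refutes C w l (h (forces B w k))
  refutes (□ n B)  w m h with irrefutable w m
  ... | a = refutes B (world a) (sub (here refl)) (h (λ k → sub (there k)))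
    where sub = proj₁ (proj₂ (proj₂ (proj₂ a)))
  refutes (□⁺ n B) w@(s , s∈U , _) m h
    with escape (irrefutable w m) w (⊆norm (step-closed s (U⇒⊆ s∈U)))
  ... | u , p , k = refutes B u k (h p)

  -- A world above the initial sequent would refute `A₀`, against soundness; hence all its
  -- saturations lie in `X`.
  complete : K⁺⊢ (forget A₀) → Derivable nothing ((true , A₀) ∷ [])
  complete ⊢A with world? X ((true , A₀) ∷ [])
  ... | inj₁ h = saturate (∷-closed (self∈ true A₀) λ ())
    (λ t t∈U sat sub → All.lookup (proj₁ (proj₂ closed)) (h t t∈U sat sub) sat)
  ... | inj₂ a@(_ , _ , _ , sub , _) =
    ⊥-elim (refutes A₀ (world a) (sub (here refl)) (sound ⊢A (world a)))

mainTheorem1 : (A : Fm) → K⁺⊢ A →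
    Σ JFm (λ B → Realization A B × Normal B × Σ (J⁺Proof B) (λ π → Injective π))
mainTheorem1 A ⊢A =
  derivable⇒realization A (Search.complete (label 0 A) (subst K⁺⊢_ (sym (forget-label 0 A)) ⊢A))
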